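{- The formal system $\mathbf{LA}$ is Kripke complete with respect to $\mathbf{LA}$-frames: for finite formulae $A_1,\dots,A_n,B$, if for every $\mathbf{LA}$-frame $(\mathcal W,\rhd,R)$, every hereditary valuation $\xi$ and every $p\in\mathcal W$, $\models^\xi_pA_i$ for all $i$ implies $\models^\xi_pB$, then $\{A_1,\dots,A_n\}\vdash B$ is derivable in $\mathbf{LA}$.
   Context: Finite formulae are generated by $A::=X\mid A\to B\mid\bullet A$ from propositional variables $X$ (no fixed-point operator). Judgments $\Gamma\vdash A$ with $\Gamma$ a finite set of formulae; $\bullet\Gamma=\{\bullet C\mid C\in\Gamma\}$. The system $\mathbf{miK4}$ has rules: $\Gamma\cup\{A\}\vdash A$; from $\Gamma_1\vdash A$ infer $\bullet\Gamma_1\cup\Gamma_2\vdash\bullet A$; from $\Gamma\vdash\bullet A$ infer $\Gamma\vdash\bullet\bullet A$; from $\Gamma\cup\{A\}\vdash B$ infer $\Gamma\vdash A\to B$; from $\Gamma_1\vdash A\to B$ and $\Gamma_2\vdash A$ infer $\Gamma_1\cup\Gamma_2\vdash B$. $\mathbf{miGL}$ adds the rule: from $\Gamma\vdash\bullet(\bullet A\to A)$ infer $\Gamma\vdash\bullet A$. $\mathbf{miGLC}$ adds to $\mathbf{miGL}$ the rule: from $\Gamma\vdash A$ infer $\Gamma\vdash\bullet A$. $\mathbf{LA}$ adds to $\mathbf{miGLC}$ the rule: from $\Gamma\vdash\bullet A\to\bullet B$ infer $\Gamma\vdash\bullet(A\to B)$. $\mathbf{LA}$-frames: triples $(\mathcal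 W,\rhd,R)$ with $\mathcal W$ nonempty; no infinite chain $p_0\rhd p_1\rhd\cdots$; $R$ reflexive and transitive; $pRq\rhd r\Rightarrow p\rhd r$; $p\rhd q\Rightarrow pRq$; if $p\rhd qRq'$ then there is $r$ with $pRr\rhd q'$ and $r\rhd s\Rightarrow q'Rs$ for all $s$. A valuation $\xi$ maps each variable to a function $\mathcal W\to\{\mathbf t,\mathbf f\}$; hereditary iff $pRq$ and $\xi(X)(p)=\mathbf t$ imply $\xi(X)(q)=\mathbf t$. Forcing: $\models^\xi_pX$ iff $\xi(X)(p)=\mathbf t$; $\models^\xi_p\bullet A$ iff $\models^\xi_qA$ for all $q$ with $p\rhd q$; $\models^\xi_pA\to B$ iff for all $q$ with $pRq$, $\models^\xi_qA$ implies $\models^\xi_qB$. -}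

module Defs where

open import Data.Nat using (ℕ; suc)
open import Data.Bool using (Bool; true)
open import Data.List using (List; []; _∷_; _++_; map)
open import Data.List.Membership.Propositional using (_∈_)
open import Data.Product using (Σ; _×_; ∃)
open import Relation.Nullary using (¬_)
open import Relation.Binary.PropositionalEquality using (_≡_)
open import Function.Bundles using (_⇔_)

infixr 6 _⇒_
data Formula : Set where
  var : ℕ → Formula
  _⇒_ : Formula → Formula → Formula
  •_  : Formula → Formula

-- Contexts are finite sets of formulae, represented by lists taken up to
-- extensional (set) equality.
Ctx : Set
Ctx = List Formula

•Ctx : Ctx → Ctx
•Ctx = map •_

_≈ˢ_ : Ctx → Ctx → Set
Γ ≈ˢ Δ = ∀ C → (C ∈ Γ) ⇔ (C ∈ Δ)

-- The system LA (= miK4 + GL rule + C rule + LA rule).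
-- Whenever a rule's conclusion context is a union, any list denoting the
-- same finite set is allowed.
infix 4 _⊢_
data _⊢_ : Ctx → Formula → Set where
  ax    : ∀ {Γ A} → A ∈ Γ → Γ ⊢ A
  box   : ∀ {Γ₁ Γ₂ Δ A} → Γ₁ ⊢ A → Δ ≈ˢ (•Ctx Γ₁ ++ Γ₂) → Δ ⊢ • A
  four  : ∀ {Γ A} → Γ ⊢ • A → Γ ⊢ • • A
  ⇒I    : ∀ {Γ Γ' A B} → Γ' ⊢ B → Γ' ≈ˢ (A ∷ Γ) → Γ ⊢ A ⇒ B
  ⇒E    : ∀ {Γ₁ Γ₂ Δ A B} → Γ₁ ⊢ A ⇒ B → Γ₂ ⊢ A → Δ ≈ˢ (Γ₁ ++ Γ₂) → Δ ⊢ B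
  gl    : ∀ {Γ A} → Γ ⊢ • ((• A) ⇒ A) → Γ ⊢ • A
  cRule : ∀ {Γ A} → Γ ⊢ A → Γ ⊢ • A
  laRule : ∀ {Γ A B} → Γ ⊢ (• A) ⇒ (• B) → Γ ⊢ • (A ⇒ B)

record LAFrame : Set₁ where
  field
    W      : Set
    inhabited : W
    _▷_    : W → W → Set
    R      : W → W → Set
    noChain : ¬ (Σ (ℕ → W) λ f → ∀ n → f n ▷ f (suc n))
    R-refl  : ∀ p → R p p
    R-trans : ∀ {p q r} → R p q → R q r → R p r
    R▷      : ∀ {p q r} → R p q → q ▷ r → p ▷ r
    ▷⇒R     : ∀ {p q} → p ▷ q → R p q
    ▷R      : ∀ {p q q'} → p ▷ q → R q q' →
              Σ W λ r → R p r × (r ▷ q') × (∀ s → r ▷ s → R q' s)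

module _ (F : LAFrame) where
  open LAFrame F

  Valuation : Set
  Valuation = ℕ → W → Bool

  Hereditary : Valuation → Set
  Hereditary ξ = ∀ X {p q} → R p q → ξ X p ≡ true → ξ X q ≡ true

  forces : Valuation → W → Formula → Set
  forces ξ p (var X) = ξ X p ≡ true
  forces ξ p (• A)   = ∀ q → p ▷ q → forces ξ q A
  forces ξ p (A ⇒ B) = ∀ q → R p q → forces ξ q A → forces ξ q B

{-# OPTIONS --safe #-}
module Submission where

open import Defs
open import Data.Bool using (Bool; true; false)
open import Data.Empty using (⊥-elim)
open import Data.Fin using (Fin; zero; suc; punchIn; punchOut)
open import Data.Fin.Properties using (any?; all?; punchIn-punchOut; punchOut-punchIn; punchInᵢ≢i) renaming (_≟_ to _≟ᶠ_)
open import Data.Fin.Subset using (Subset; ⊥; _⊃_) renaming (_∈_ to _∈ˢ_; _∉_ to _∉ˢ_; _⊆_ to _⊆ˢ_)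
open import Data.Fin.Subset.Induction using (⊃-wellFounded; Acc; acc)
open import Data.Fin.Subset.Properties using (_∈?_; _⊆?_; ∉⊥)
import Data.List as List
open import Data.List using (List; []; _∷_; _++_; map; foldr; concatMap; allFin; filter)
open import Data.List.Membership.DecPropositional using () renaming (_∈?_ to member)
open import Data.List.Membership.Propositional using (_∈_; lose)
open import Data.List.Membership.Propositional.Properties using (∈-++⁺ˡ; ∈-++⁺ʳ; ∈-++⁻; ∈-map⁺; ∈-map⁻; ∈-concatMap⁺; ∈-allFin; ∈-filter⁺; ∈-filter⁻)
open import Data.List.Properties using (map-id)
open import Data.List.Relation.Binary.Subset.Propositional using (_⊆_)
open import Data.List.Relation.Binary.Subset.Propositional.Properties using (∷⁺ʳ; ++⁺ʳ)
open import Data.List.Relation.Unary.Any using (here; there; index)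
open import Data.List.Relation.Unary.Any.Properties using (lookup-index)
open import Data.Nat using (ℕ; zero; suc; _+_) renaming (_≟_ to _≟ⁿ_)
open import Data.Nat.Properties using (+-suc; +-identityʳ; +-comm)
open import Data.Product using (Σ; ∃; _×_; _,_; proj₁; proj₂)
open import Data.Sum as Sum using (_⊎_; inj₁; inj₂; reduce)
open import Data.Vec using (Vec; []; _∷_; lookup; removeAt; tabulate; fromList)
open import Data.Vec.Properties using (removeAt-punchOut; lookup∘tabulate; lookup⇒[]=; []=⇒lookup)
open import Function using (_∘_; id)
open import Function.Bundles using (mk⇔; Equivalence)
open import Relation.Binary.PropositionalEquality using (_≡_; refl; sym; trans; cong; cong₂; subst)
open import Relation.Nullary using (¬_; Dec; yes; no; does)
open import Relation.Nullary.Decidable using (_×-dec_; _→-dec_; ¬?; map′; dec-true; decidable-stable)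

-- Bullets distribute over ⇒ in LA, so every formula becomes an implicational formula over the
-- atoms •ᵏX. By Diego's theorem finitely many "points" (theories maximal with respect to an
-- atomic goal) decide all such formulas with k ≤ n. Take the points U for k ≤ n and P for
-- k ≤ n + 1. A point i of P has two upward closed traces on U: ρ i, for the formulas A it
-- derives, and σ i, for the formulas A such that it derives •A. The worlds of the countermodel
-- are eventually empty sequences of up-sets of U whose consecutive members are the ρ- and the
-- σ-trace of one set of points of P, and the successors of a world lie above its tail. Löb's
-- rule shows that such sequences exhaust U.
-- Consistency of points is not decided beforehand. Instead each property required of the traces
-- either holds or exhibits an inconsistent point, which can be dropped.

-- Derived rules of LA

≈ˢ-refl : ∀ {Γ} → Γ ≈ˢ Γ
≈ˢ-refl C = mk⇔ id id

weaken : ∀ {Γ Δ A} → Γ ⊆ Δ → Γ ⊢ A → Δ ⊢ A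
weaken sub (ax A∈Γ) = ax (sub A∈Γ)
weaken {Δ = Δ} sub (box {Γ₁} d eq) = box {Γ₂ = Δ} d λ C → mk⇔ (∈-++⁺ʳ (•Ctx Γ₁)) (absorb C)
  where
  absorb : ∀ C → C ∈ •Ctx Γ₁ ++ Δ → C ∈ Δ
  absorb C m with ∈-++⁻ (•Ctx Γ₁) m
  ... | inj₁ C∈•Γ₁ = sub (Equivalence.from (eq C) (∈-++⁺ˡ C∈•Γ₁))
  ... | inj₂ C∈Δ = C∈Δ
weaken sub (four d) = four (weaken sub d)
weaken sub (⇒I {A = A} d eq) = ⇒I (weaken (λ {C} m → ∷⁺ʳ A sub (Equivalence.to (eq C) m)) d) ≈ˢ-refl
weaken {Δ = Δ} sub (⇒E {Γ₁} {Γ₂} d e eq) =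
  ⇒E (weaken (λ {C} m → sub (Equivalence.from (eq C) (∈-++⁺ˡ m))) d)
     (weaken (λ {C} m → sub (Equivalence.from (eq C) (∈-++⁺ʳ Γ₁ m))) e)
     (λ C → mk⇔ ∈-++⁺ˡ (λ m → reduce (∈-++⁻ Δ m)))
weaken sub (gl d) = gl (weaken sub d)
weaken sub (cRule d) = cRule (weaken sub d)
weaken sub (laRule d) = laRule (weaken sub d)

weaken∷ : ∀ {Γ A B} → Γ ⊢ B → A ∷ Γ ⊢ B
weaken∷ = weaken there

lam : ∀ {Γ A B} → A ∷ Γ ⊢ B → Γ ⊢ A ⇒ B
lam d = ⇒I d ≈ˢ-refl

app : ∀ {Γ A B} → Γ ⊢ A ⇒ B → Γ ⊢ A → Γ ⊢ B
app {Γ} d e = ⇒E {Γ₁ = Γ} {Γ₂ = Γ} d e λ C → mk⇔ ∈-++⁺ˡ (λ m → reduce (∈-++⁻ Γ m))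

unlam : ∀ {Γ A B} → Γ ⊢ A ⇒ B → A ∷ Γ ⊢ B
unlam d = app (weaken∷ d) (ax (here refl))

cut₁ : ∀ {Γ A B} → Γ ⊢ A → A ∷ Γ ⊢ B → Γ ⊢ B
cut₁ d e = app (lam e) d

infix 4 _⊢*_
_⊢*_ : Ctx → Ctx → Set
Δ ⊢* Γ = ∀ {C} → C ∈ Γ → Δ ⊢ C

cut : ∀ {Γ Δ A} → Δ ⊢* Γ → Γ ⊢ A → Δ ⊢ A
cut {[]} σ d = weaken (λ ()) d
cut {C ∷ Γ} σ d = app (cut {Γ} (σ ∘ there) (lam d)) (σ (here refl))

∷-⊢* : ∀ {Γ Δ A} → Δ ⊢ A → Δ ⊢* Γ → Δ ⊢* A ∷ Γ
∷-⊢* d σ (here refl) = d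
∷-⊢* d σ (there m) = σ m

++-⊢* : ∀ Γ {Γ' Δ} → Δ ⊢* Γ → Δ ⊢* Γ' → Δ ⊢* Γ ++ Γ'
++-⊢* Γ σ τ m with ∈-++⁻ Γ m
... | inj₁ m' = σ m'
... | inj₂ m' = τ m'

infixr 5 _⇒*_
_⇒*_ : Ctx → Formula → Formula
Γ ⇒* A = foldr _⇒_ A Γ

lam* : ∀ Γ {Δ A} → Γ ++ Δ ⊢ A → Δ ⊢ Γ ⇒* A
lam* [] d = d
lam* (C ∷ Γ) {Δ} d = lam (lam* Γ (weaken swap d))
  where
  swap : C ∷ Γ ++ Δ ⊆ Γ ++ C ∷ Δ
  swap (here refl) = ∈-++⁺ʳ Γ (here refl)
  swap (there m) = ++⁺ʳ Γ there m

app* : ∀ Γ {Δ A} → Δ ⊢ Γ ⇒* A → Δ ⊢* Γ → Δ ⊢ A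
app* [] d σ = d
app* (C ∷ Γ) d σ = app* Γ (app d (σ (here refl))) (σ ∘ there)

•-mono : ∀ {Γ A} → Γ ⊢ A → •Ctx Γ ⊢ • A
•-mono {Γ} d = box {Γ₂ = •Ctx Γ} d λ C → mk⇔ ∈-++⁺ˡ (λ m → reduce (∈-++⁻ (•Ctx Γ) m))

-- Rule C puts a bullet on `• A ⇒ A`, `gl` turns that into `• A`, and modus ponens gives `A`.
löb : ∀ {Γ A} → • A ∷ Γ ⊢ A → Γ ⊢ A
löb d = app (lam d) (gl (cRule (lam d)))

-- Simultaneous Löb's rule. Under `• A` the other members follow by induction and rule C adds their
-- bullets, so `A` rests on `• A` alone and `löb` applies.
löb* : ∀ Θ {Γ} → •Ctx Θ ++ Γ ⊢* Θ → Γ ⊢* Θ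
löb* (A ∷ Θ) {Γ} σ = ∷-⊢* A-prov (λ m → cut₁ (cRule A-prov) (rest m))
  where
  swap : • A ∷ •Ctx Θ ++ Γ ⊆ •Ctx Θ ++ • A ∷ Γ
  swap (here refl) = ∈-++⁺ʳ (•Ctx Θ) (here refl)
  swap (there m) = ++⁺ʳ (•Ctx Θ) there m
  rest : • A ∷ Γ ⊢* Θ
  rest = löb* Θ (λ m → weaken swap (σ (there m)))
  •rest : • A ∷ Γ ⊢* •Ctx Θ
  •rest m with ∈-map⁻ •_ m
  ... | _ , m' , refl = cRule (rest m')
  A-prov : Γ ⊢ A
  A-prov = löb (cut (∷-⊢* (ax (here refl)) (++-⊢* (•Ctx Θ) •rest (ax ∘ there))) (σ (here refl)))

-- Moving a bullet inside implications

shift : Formula → Formula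
shift (var x) = • var x
shift (A ⇒ B) = shift A ⇒ shift B
shift (• A) = • • A

mutual
  -- At an implication this direction is the K axiom and the converse is `laRule`. The antecedent
  -- makes each direction call the other.
  •⊢shift : ∀ A {Γ} → Γ ⊢ • A → Γ ⊢ shift A
  •⊢shift (var x) d = d
  •⊢shift (• A) d = d
  •⊢shift (A ⇒ B) d = lam (•⊢shift B (cut (∷-⊢* (weaken∷ d) (∷-⊢* (shift⊢• A (ax (here refl))) λ ()))
                                        (•-mono {A ⇒ B ∷ A ∷ []} (app (ax (here refl)) (ax (there (here refl)))))))

  shift⊢• : ∀ A {Γ} → Γ ⊢ shift A → Γ ⊢ • A
  shift⊢• (var x) d = d
  shift⊢• (• A) d = d
  shift⊢• (A ⇒ B) d = laRule (lam (shift⊢• B (app (weaken∷ d) (•⊢shift A (ax (here refl))))))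

shift-mono : ∀ {Γ A} → Γ ⊢ A → map shift Γ ⊢ shift A
shift-mono {Γ} {A} d = •⊢shift A (cut bullets (•-mono d))
  where
  bullets : map shift Γ ⊢* •Ctx Γ
  bullets m with ∈-map⁻ •_ m
  ... | C , m' , refl = shift⊢• C (ax (∈-map⁺ shift m'))

-- Removing the bullet from a theorem

-- A Kripke model on contexts ordered by entailment, in which the only • successor of (a copy of)
-- Γ is the theory of Γ itself.
Glued : Ctx → Formula → Set
Glued Γ (var x) = Γ ⊢ var x
Glued Γ (A ⇒ B) = Γ ⊢ A ⇒ B × (∀ Δ → Δ ⊢* Γ → Glued Δ A → Glued Δ B)
Glued Γ (• A) = Γ ⊢ A

glued-sound : ∀ A {Γ} → Glued Γ A → Γ ⊢ A
glued-sound (var x) g = g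
glued-sound (A ⇒ B) g = proj₁ g
glued-sound (• A) g = cRule g

glued-mono : ∀ A {Γ Δ} → Δ ⊢* Γ → Glued Γ A → Glued Δ A
glued-mono (var x) σ g = cut σ g
glued-mono (A ⇒ B) σ (d , g) = cut σ d , λ Δ' τ → g Δ' (λ m → cut τ (σ m))
glued-mono (• A) σ g = cut σ g

glued-derivable : ∀ {Γ A Δ} → Γ ⊢ A → (∀ {C} → C ∈ Γ → Glued Δ C) → Glued Δ A
glued-derivable (ax m) γ = γ m
glued-derivable (box {Γ₁} d eq) γ =
  cut (λ {C} m → γ (Equivalence.from (eq (• C)) (∈-++⁺ˡ (∈-map⁺ •_ m)))) d
glued-derivable (four d) γ = cRule (glued-derivable d γ)
glued-derivable {A = A ⇒ B} {Δ} (⇒I {Γ} d eq) γ =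
  lam (cut (λ {C} m → entails (Equivalence.to (eq C) m)) d) ,
  λ Δ' σ gA → glued-derivable d (λ {C} m → extend σ gA (Equivalence.to (eq C) m))
  where
  entails : A ∷ Δ ⊢* A ∷ Γ
  entails = ∷-⊢* (ax (here refl)) (λ {C} m → weaken∷ (glued-sound C (γ m)))
  extend : ∀ {Δ'} → Δ' ⊢* Δ → Glued Δ' A → ∀ {C} → C ∈ A ∷ Γ → Glued Δ' C
  extend σ gA (here refl) = gA
  extend σ gA {C} (there m) = glued-mono C σ (γ m)
glued-derivable (⇒E {Γ₁} d e eq) γ =
  proj₂ (glued-derivable d (λ {C} m → γ (Equivalence.from (eq C) (∈-++⁺ˡ m)))) _ ax
        (glued-derivable e (λ {C} m → γ (Equivalence.from (eq C) (∈-++⁺ʳ Γ₁ m))))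
glued-derivable (gl d) γ = löb (unlam (glued-derivable d γ))
glued-derivable (cRule {Γ} d) γ = cut (λ {C} m → glued-sound C (γ m)) d
-- At `A ∷ Δ` the formula `• A` is glued because `A` is derivable there. Hence `• B` is glued, that
-- is, `A ∷ Δ` derives `B`.
glued-derivable (laRule d) γ =
  lam (proj₂ (glued-derivable d γ) _ (weaken∷ ∘ ax) (ax (here refl)))

unbox : ∀ {A} → [] ⊢ • A → [] ⊢ A
unbox d = glued-derivable d λ ()

-- Finitely many points suffice for implicational formulas over finitely many atoms

data Over (At : List Formula) : Formula → Set where
  atom : ∀ {a} → a ∈ At → Over At a
  _⇒_  : ∀ {A B} → Over At A → Over At B → Over At (A ⇒ B)

over-⇒* : ∀ {At} Γ {A} → (∀ {C} → C ∈ Γ → Over At C) → Over At A → Over At (Γ ⇒* A)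
over-⇒* [] o oA = oA
over-⇒* (C ∷ Γ) o oA = o (here refl) ⇒ over-⇒* Γ (o ∘ there) oA

-- A theory maximal with respect to not deriving `goal`, in positive form: whatever is not derived
-- yields the goal. Consistency is left open. Atoms are decided by membership, so that valuations
-- can be computed.
record Point (At : List Formula) : Set where
  field
    ctx      : Ctx
    goal     : Formula
    ctx-over : ∀ {C} → C ∈ ctx → Over At C
    goal∈At  : goal ∈ At
    decide   : ∀ {A} → Over At A → ctx ⊢ A ⊎ A ∷ ctx ⊢ goal
    decide-atom : ∀ {a} → a ∈ At → a ∈ ctx ⊎ a ∷ ctx ⊢ goal

  -- For a consistent point this is the weakest formula over the atoms that it does not derive: by
  -- `refutes-descr` every refuted formula entails it.
  descr : Formula
  descr = ctx ⇒* goal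

  over : Over At descr
  over = over-⇒* ctx ctx-over (atom goal∈At)

open Point

Refutes : ∀ {At} → Point At → Formula → Set
Refutes w A = A ∷ ctx w ⊢ goal w

Inconsistent : ∀ {At} → Point At → Set
Inconsistent w = ctx w ⊢ goal w

refutes-descr : ∀ {At} (w : Point At) {A} → Refutes w A → A ∷ [] ⊢ descr w
refutes-descr w {A} r = lam* (ctx w) (weaken (λ { (here refl) → ∈-++⁺ʳ (ctx w) (here refl) ; (there m) → ∈-++⁺ˡ m }) r)


private variable
  At : List Formula

-- Completeness of `C` for theories extending `T`. Classically: if `Δ` does not derive `F`, some
-- point of `C` refutes `F` and remains consistent with `Δ`. The positive form avoids deciding
-- derivability.
Separates : Ctx → List (Point At) → Set
Separates {At} T C = ∀ {Δ F} → Over At F → T ⊆ Δ →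
  (∀ {w} → w ∈ C → Refutes w F → Δ ++ ctx w ⊢ goal w) → Δ ⊢ F

data Choice (x : Formula) : Ctx → Ctx → Set where
  []  : Choice x [] []
  pos : ∀ {φ Φ χ} → Choice x Φ χ → Choice x (φ ∷ Φ) (φ ∷ χ)
  neg : ∀ {φ Φ χ} → Choice x Φ χ → Choice x (φ ∷ Φ) ((φ ⇒ x) ∷ χ)

choice-decides : ∀ {x Φ χ φ} → Choice x Φ χ → φ ∈ Φ → φ ∈ χ ⊎ (φ ⇒ x) ∈ χ
choice-decides (pos c) (here refl) = inj₁ (here refl)
choice-decides (neg c) (here refl) = inj₂ (here refl)
choice-decides (pos c) (there m) = Sum.map there there (choice-decides c m)
choice-decides (neg c) (there m) = Sum.map there there (choice-decides c m)

choice-over : ∀ {x Φ χ} → Choice x Φ χ → Over At x → (∀ {C} → C ∈ Φ → Over At C) →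
  ∀ {C} → C ∈ χ → Over At C
choice-over (pos c) ox o (here refl) = o (here refl)
choice-over (pos c) ox o (there m) = choice-over c ox (o ∘ there) m
choice-over (neg c) ox o (here refl) = o (here refl) ⇒ ox
choice-over (neg c) ox o (there m) = choice-over c ox (o ∘ there) m

choices : ∀ x Φ → List (∃ (Choice x Φ))
choices x [] = ([] , []) ∷ []
choices x (φ ∷ Φ) = map (λ (χ , c) → φ ∷ χ , pos c) (choices x Φ) ++
                    map (λ (χ , c) → (φ ⇒ x) ∷ χ , neg c) (choices x Φ)

-- φ and φ ⇒ x together exhaust all cases as long as the goal is x.
choices-exhaust : ∀ {x} Φ {Δ} → (∀ {c} → c ∈ choices x Φ → Δ ++ proj₁ c ⊢ x) → Δ ⊢ x
choices-exhaust [] {Δ} h = weaken (λ m → fromNil (∈-++⁻ Δ m)) (h (here refl))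
  where
  fromNil : ∀ {C} → C ∈ Δ ⊎ C ∈ [] → C ∈ Δ
  fromNil (inj₁ m) = m
choices-exhaust {x} (φ ∷ Φ) {Δ} h = cut₁ φ⇒x (branch (λ m → ∈-++⁺ʳ _ (∈-map⁺ _ m)))
  where
  branch : ∀ {ψ} {f : ∀ {χ} → Choice x Φ χ → Choice x (φ ∷ Φ) (ψ ∷ χ)} →
    (∀ {c} → c ∈ choices x Φ → (ψ ∷ proj₁ c , f (proj₂ c)) ∈ choices x (φ ∷ Φ)) → ψ ∷ Δ ⊢ x
  branch {ψ} inc = choices-exhaust Φ λ {c} m → weaken (swap (proj₁ c)) (h (inc m))
    where
    swap : ∀ χ → Δ ++ ψ ∷ χ ⊆ ψ ∷ Δ ++ χ
    swap χ m with ∈-++⁻ Δ m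
    ... | inj₁ m' = there (∈-++⁺ˡ m')
    ... | inj₂ (here refl) = here refl
    ... | inj₂ (there m') = there (∈-++⁺ʳ Δ m')
  φ⇒x : Δ ⊢ φ ⇒ x
  φ⇒x = lam (branch (λ m → ∈-++⁺ˡ (∈-map⁺ _ m)))

∀∈⊎ : ∀ {X : Set} {A : X → Set} {B : Set} (xs : List X) →
  (∀ {x} → x ∈ xs → A x ⊎ B) → (∀ {x} → x ∈ xs → A x) ⊎ B
∀∈⊎ [] f = inj₁ λ ()
∀∈⊎ (x ∷ xs) f with f (here refl) | ∀∈⊎ xs (f ∘ there)
... | inj₂ b | _ = inj₂ b
... | inj₁ _ | inj₂ b = inj₂ b
... | inj₁ a | inj₁ g = inj₁ λ { (here refl) → a ; (there m) → g m }

-- Above a point with goal x every strictly larger theory contains x, so such theories are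
-- described by the points C' for which x counts as true; the point only has to choose which
-- atoms hold at it and which points of C' lie above it.
module Extend (T : Ctx) (T⊆At : T ⊆ At) (x : Formula) (x∈At : x ∈ At)
              (C' : List (Point At)) (sep : Separates (x ∷ T) C') where

  Φ : Ctx
  Φ = At ++ map descr C'

  Φ-over : ∀ {C} → C ∈ Φ → Over At C
  Φ-over m with ∈-++⁻ At m
  ... | inj₁ m' = atom m'
  ... | inj₂ m' with ∈-map⁻ descr m'
  ... | w , _ , refl = over w

  module _ {χ : Ctx} (c : Choice x Φ χ) where
    Dec⊢ : Formula → Set
    Dec⊢ A = χ ++ T ⊢ A ⊎ A ∷ χ ++ T ⊢ x

    fromChoice : ∀ {A} → A ∈ χ ⊎ (A ⇒ x) ∈ χ → Dec⊢ A
    fromChoice (inj₁ m) = inj₁ (ax (∈-++⁺ˡ m))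
    fromChoice (inj₂ m) = inj₂ (unlam (ax (∈-++⁺ˡ m)))

    -- The hard case is `E ⇒ F` when both sides yield `x`. If `χ` contains `descr w` for every `w`
    -- refuting `E ⇒ F`, then `sep` derives `E ⇒ F` from `x`, hence from `E`. Otherwise some
    -- `descr w ⇒ x` is in `χ`, and `E ⇒ F` entails `descr w`.
    decideχ : ∀ {A} → Over At A → Dec⊢ A
    decideχ (atom m) = fromChoice (choice-decides c (∈-++⁺ˡ m))
    decideχ {E ⇒ F} (oE ⇒ oF) with decideχ oF | decideχ oE
    ... | inj₁ dF | _ = inj₁ (lam (weaken∷ dF))
    ... | inj₂ rF | inj₁ dE = inj₂ (cut (∷-⊢* (app (ax (here refl)) (weaken∷ dE)) (ax ∘ there)) rF)
    ... | inj₂ rF | inj₂ rE = conclude (∀∈⊎ C' above)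
      where
      Θ : Ctx
      Θ = χ ++ T
      above : ∀ {w} → w ∈ C' →
        (Refutes w (E ⇒ F) → (x ∷ Θ) ++ ctx w ⊢ goal w) ⊎ (E ⇒ F) ∷ Θ ⊢ x
      above {w} m with decide w (oE ⇒ oF)
      ... | inj₁ d = inj₁ λ r → weaken (∈-++⁺ʳ (x ∷ Θ)) (cut₁ d r)
      ... | inj₂ r with choice-decides c (∈-++⁺ʳ At (∈-map⁺ descr m))
      ... | inj₁ m' = inj₁ λ _ → app* (ctx w) (ax (there (∈-++⁺ˡ (∈-++⁺ˡ m')))) (λ n → ax (∈-++⁺ʳ (x ∷ Θ) n))
      ... | inj₂ m' = inj₂ (app (ax (there (∈-++⁺ˡ m')))
                                (weaken (λ { (here refl) → here refl }) (refutes-descr w r)))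
      conclude : (∀ {w} → w ∈ C' → Refutes w (E ⇒ F) → (x ∷ Θ) ++ ctx w ⊢ goal w) ⊎ (E ⇒ F) ∷ Θ ⊢ x →
        Dec⊢ (E ⇒ F)
      conclude (inj₂ r) = inj₂ r
      conclude (inj₁ f) = inj₁ (lam (app (cut (∷-⊢* rE (ax ∘ there)) E⇒F) (ax (here refl))))
        where
        E⇒F : x ∷ Θ ⊢ E ⇒ F
        E⇒F = sep (oE ⇒ oF) (λ { (here refl) → here refl ; (there m) → there (∈-++⁺ʳ χ m) }) f

    point : Point At
    point .ctx = χ ++ T
    point .goal = x
    point .ctx-over m with ∈-++⁻ χ m
    ... | inj₁ m' = choice-over c (atom x∈At) Φ-over m'
    ... | inj₂ m' = atom (T⊆At m')
    point .goal∈At = x∈At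
    point .decide = decideχ
    point .decide-atom m with choice-decides c (∈-++⁺ˡ m)
    ... | inj₁ m' = inj₁ (∈-++⁺ˡ m')
    ... | inj₂ m' = inj₂ (unlam (ax (∈-++⁺ˡ m')))

  points : List (Point At)
  points = map (λ c → point (proj₂ c)) (choices x Φ)

  points-exhaust : ∀ {Δ} → T ⊆ Δ → (∀ {w} → w ∈ points → Δ ++ ctx w ⊢ goal w) → Δ ⊢ x
  points-exhaust {Δ} T⊆Δ h = choices-exhaust Φ λ {c} m → weaken (rearrange (proj₁ c)) (h (∈-map⁺ _ m))
    where
    rearrange : ∀ χ → Δ ++ χ ++ T ⊆ Δ ++ χ
    rearrange χ m with ∈-++⁻ Δ m
    ... | inj₁ m' = ∈-++⁺ˡ m'
    ... | inj₂ m' with ∈-++⁻ χ m'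
    ... | inj₁ m'' = ∈-++⁺ʳ Δ m''
    ... | inj₂ m'' = ∈-++⁺ˡ (T⊆Δ m'')

  points-goal : ∀ {w} → w ∈ points → goal w ≡ x
  points-goal m with ∈-map⁻ _ m
  ... | _ , _ , refl = refl

removeAt-punchIn : ∀ {n} {A : Set} (xs : Vec A (suc n)) i j → lookup (removeAt xs i) j ≡ lookup xs (punchIn i j)
removeAt-punchIn xs i j = trans (cong (lookup (removeAt xs i)) (sym (punchOut-punchIn i)))
                                (removeAt-punchOut xs (punchInᵢ≢i i j ∘ sym))

-- The implicational fragment is locally finite (Diego's theorem).
diego : ∀ {n} T (L : Vec Formula n) → T ⊆ At → (∀ i → lookup L i ∈ At) →
  (∀ {a} → a ∈ At → a ∈ T ⊎ ∃ λ i → lookup L i ≡ a) → Σ (List (Point At)) (Separates T)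
diego {At} {zero} T L T⊆At L⊆At cover = [] , separates
  where
  -- All atoms lie in `T`, so every formula over them is derivable.
  separates : Separates T []
  separates (oE ⇒ oF) T⊆Δ h = lam (separates oF (there ∘ T⊆Δ) λ ())
  separates (atom m) T⊆Δ h with cover m
  ... | inj₁ m' = ax (T⊆Δ m')
diego {At} {suc n} T L T⊆At L⊆At cover = concatMap points (allFin (suc n)) , separates
  where
  smaller : ∀ i → Σ (List (Point At)) (Separates (lookup L i ∷ T))
  smaller i = diego (lookup L i ∷ T) (removeAt L i) (λ { (here refl) → L⊆At i ; (there m) → T⊆At m }) remaining cover'
    where
    remaining : ∀ j → lookup (removeAt L i) j ∈ At
    remaining j = subst (_∈ At) (sym (removeAt-punchIn L i j)) (L⊆At (punchIn i j))
    cover' : ∀ {a} → a ∈ At → a ∈ lookup L i ∷ T ⊎ ∃ λ j → lookup (removeAt L i) j ≡ a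
    cover' m with cover m
    ... | inj₁ m' = inj₁ (there m')
    ... | inj₂ (j , eq) with i ≟ᶠ j
    ... | yes refl = inj₁ (here (sym eq))
    ... | no i≢j = inj₂ (punchOut i≢j , trans (removeAt-punchOut L i≢j) eq)

  module E i = Extend T T⊆At (lookup L i) (L⊆At i) (proj₁ (smaller i)) (proj₂ (smaller i))

  points : Fin (suc n) → List (Point At)
  points i = E.points i

  separates : Separates T (concatMap points (allFin (suc n)))
  separates {Δ} (_⇒_ {E} {F} oE oF) T⊆Δ h = lam (separates oF (there ∘ T⊆Δ) step)
    where
    step : ∀ {w} → w ∈ concatMap points (allFin (suc n)) → Refutes w F → (E ∷ Δ) ++ ctx w ⊢ goal w
    -- A point refuting `F` either yields its goal from `E`, or derives `E` and so refutes `E ⇒ F`,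
    -- where `h` applies.
    step {w} m r with decide w oE
    ... | inj₂ rE = weaken (∷⁺ʳ E (∈-++⁺ʳ Δ)) rE
    ... | inj₁ dE = weaken∷ (h m (cut (∷-⊢* (app (ax (here refl)) (weaken∷ dE)) (ax ∘ there)) r))
  separates {Δ} (atom m) T⊆Δ h with cover m
  ... | inj₁ m' = ax (T⊆Δ m')
  ... | inj₂ (i , refl) = E.points-exhaust i T⊆Δ λ {w} m' →
    h (∈-concatMap⁺ points (lose (∈-allFin i) m')) (ax (here (E.points-goal i m')))

-- Pushing bullets to the variables

push : Formula → Formula
push (var x) = var x
push (A ⇒ B) = push A ⇒ push B
push (• A) = shift (push A)

-- The formulas `•ᵏ x` with `k ≤ n` and `x` in `V`.
Atoms : List ℕ → ℕ → List Formula
Atoms V zero = map var V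
Atoms V (suc n) = map var V ++ map •_ (Atoms V n)

data Fits (V : List ℕ) : ℕ → Formula → Set where
  var : ∀ {n x} → x ∈ V → Fits V n (var x)
  _⇒_ : ∀ {n A B} → Fits V n A → Fits V n B → Fits V n (A ⇒ B)
  •_  : ∀ {n A} → Fits V n A → Fits V (suc n) (• A)

fits-suc : ∀ {V n A} → Fits V n A → Fits V (suc n) A
fits-suc (var m) = var m
fits-suc (fA ⇒ fB) = fits-suc fA ⇒ fits-suc fB
fits-suc (• fA) = • fits-suc fA

var∈Atoms : ∀ {V} n {x} → x ∈ V → var x ∈ Atoms V n
var∈Atoms zero m = ∈-map⁺ var m
var∈Atoms (suc n) m = ∈-++⁺ˡ (∈-map⁺ var m)

•∈Atoms : ∀ V n {a} → a ∈ Atoms V n → • a ∈ Atoms V (suc n)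
•∈Atoms V n m = ∈-++⁺ʳ (map var V) (∈-map⁺ •_ m)

Atoms-suc : ∀ V n → Atoms V n ⊆ Atoms V (suc n)
Atoms-suc V zero m = ∈-++⁺ˡ m
Atoms-suc V (suc n) m with ∈-++⁻ (map var V) m
... | inj₁ m' = ∈-++⁺ˡ m'
... | inj₂ m' with ∈-map⁻ •_ m'
... | _ , m'' , refl = •∈Atoms V (suc n) (Atoms-suc V n m'')

shift-atom : ∀ V n {a} → a ∈ Atoms V n → shift a ≡ • a
shift-atom V zero m with ∈-map⁻ var m
... | _ , _ , refl = refl
shift-atom V (suc n) m with ∈-++⁻ (map var V) m
shift-atom V (suc n) m | inj₁ m' with ∈-map⁻ var m'
... | _ , _ , refl = refl
shift-atom V (suc n) m | inj₂ m' with ∈-map⁻ •_ m'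
... | _ , _ , refl = refl

⇒∉Atoms : ∀ V n {A B} → ¬ (A ⇒ B ∈ Atoms V n)
⇒∉Atoms V n a∈ with shift-atom V n a∈
... | ()

over-suc : ∀ V n {A} → Over (Atoms V n) A → Over (Atoms V (suc n)) A
over-suc V n (atom m) = atom (Atoms-suc V n m)
over-suc V n (oA ⇒ oB) = over-suc V n oA ⇒ over-suc V n oB

over-shift : ∀ V n {A} → Over (Atoms V n) A → Over (Atoms V (suc n)) (shift A)
over-shift V n (atom m) = atom (subst (_∈ Atoms V (suc n)) (sym (shift-atom V n m)) (•∈Atoms V n m))
over-shift V n (oA ⇒ oB) = over-shift V n oA ⇒ over-shift V n oB

fits-over : ∀ {V n A} → Fits V n A → Over (Atoms V n) (push A)
fits-over {n = n} (var m) = atom (var∈Atoms n m)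
fits-over (fA ⇒ fB) = fits-over fA ⇒ fits-over fB
fits-over {V} {suc n} (• fA) = over-shift V n (fits-over fA)

-- Frames of sequences of up-sets

private variable
  m p : ℕ

⟪_⟫ : {Q : Fin m → Set} → (∀ u → Dec (Q u)) → Subset m
⟪ Q? ⟫ = tabulate (λ u → does (Q? u))

does-true : ∀ {A : Set} (A? : Dec A) → does A? ≡ true → A
does-true (yes a) _ = a

∈⟪⟫⁺ : {Q : Fin m → Set} (Q? : ∀ u → Dec (Q u)) → ∀ {u} → Q u → u ∈ˢ ⟪ Q? ⟫
∈⟪⟫⁺ Q? {u} q = lookup⇒[]= u _ (trans (lookup∘tabulate _ u) (dec-true (Q? u) q))

∈⟪⟫⁻ : {Q : Fin m → Set} (Q? : ∀ u → Dec (Q u)) → ∀ {u} → u ∈ˢ ⟪ Q? ⟫ → Q u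
∈⟪⟫⁻ Q? {u} q = does-true (Q? u) (trans (sym (lookup∘tabulate _ u)) ([]=⇒lookup q))

Relation : ℕ → ℕ → Set
Relation p m = Fin p → Subset m

UpClosed : Relation m m → Subset m → Set
UpClosed up y = ∀ {u} → u ∈ˢ y → up u ⊆ˢ y

-- For up-closed traces, `α j` is exactly the cone of `u`: the α-trace of `i` can be cut down to any
-- cone inside it without enlarging the β-trace.
Open : Relation m m → Relation p m → Relation p m → Set
Open up α β = ∀ i u → u ∈ˢ α i → ∃ λ j → u ∈ˢ α j × α j ⊆ˢ up u × β j ⊆ˢ β i

-- Equivalently, `y` and `z` are the unions of the α-traces and of the β-traces of one set of
-- points; the largest such set consists of all points with both traces inside.
Link : Relation p m → Relation p m → Subset m → Subset m → Set
Link α β y z = (∀ {u} → u ∈ˢ y → ∃ λ i → u ∈ˢ α i × α i ⊆ˢ y × β i ⊆ˢ z) ×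
               (∀ {u} → u ∈ˢ z → ∃ λ i → u ∈ˢ β i × α i ⊆ˢ y × β i ⊆ˢ z)

link-sym : {α β : Relation p m} {y z : Subset m} → Link α β y z → Link β α z y
link-sym (f , g) = (λ v → let i , a , b , c = g v in i , a , c , b) ,
                   (λ v → let i , a , b , c = f v in i , a , c , b)

-- Take for `z'` the union of all β-traces inside `z` whose α-trace lies inside `y'`. Openness
-- supplies enough such points to cover `y'`.
shrink : {up : Relation m m} {α β : Relation p m} → Open up α β → ∀ {y z y'} →
  Link α β y z → y' ⊆ˢ y → UpClosed up y' → Σ (Subset m) λ z' → z' ⊆ˢ z × Link α β y' z'
shrink {m} {p} {up} {α} {β} op {y} {z} {y'} (f , g) y'⊆y up-y' =
  ⟪ inside? ⟫ , (λ v → let _ , a , _ , c = ∈⟪⟫⁻ inside? v in c a) , left , right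
  where
  Inside : Fin m → Set
  Inside u = ∃ λ i → u ∈ˢ β i × α i ⊆ˢ y' × β i ⊆ˢ z
  inside? : ∀ u → Dec (Inside u)
  inside? u = any? λ i → (u ∈? β i) ×-dec (α i ⊆? y') ×-dec (β i ⊆? z)
  left : ∀ {u} → u ∈ˢ y' → ∃ λ i → u ∈ˢ α i × α i ⊆ˢ y' × β i ⊆ˢ ⟪ inside? ⟫
  left {u} u∈y' =
    let i , u∈αi , _ , βi⊆z = f (y'⊆y u∈y')
        j , u∈αj , αj⊆u , βj⊆βi = op i u u∈αi
        αj⊆y' = λ {v} v∈ → up-y' u∈y' {v} (αj⊆u v∈)
    in j , u∈αj , αj⊆y' , λ v∈βj → ∈⟪⟫⁺ inside? (j , v∈βj , αj⊆y' , λ w∈ → βi⊆z (βj⊆βi w∈))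
  right : ∀ {u} → u ∈ˢ ⟪ inside? ⟫ → ∃ λ i → u ∈ˢ β i × α i ⊆ˢ y' × β i ⊆ˢ ⟪ inside? ⟫
  right u∈ =
    let i , u∈βi , αi⊆y' , βi⊆z = ∈⟪⟫⁻ inside? u∈
    in i , u∈βi , αi⊆y' , λ v∈βi → ∈⟪⟫⁺ inside? (i , v∈βi , αi⊆y' , βi⊆z)

module _ (up : Relation m m) (val : Formula → Subset m) where
  mutual
    ⟦_⟧ : Formula → Subset m
    ⟦ var x ⟧ = val (var x)
    ⟦ • A ⟧ = val (• A)
    ⟦ A ⇒ B ⟧ = ⟪ implies? A B ⟫

    implies? : ∀ A B u → Dec (∀ v → v ∈ˢ up u → v ∈ˢ ⟦ A ⟧ → v ∈ˢ ⟦ B ⟧)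
    implies? A B u = all? λ v → (v ∈? up u) →-dec (v ∈? ⟦ A ⟧) →-dec (v ∈? ⟦ B ⟧)

Valid : Formula → Set₁
Valid A = ∀ F ξ → Hereditary F ξ → ∀ w → forces F ξ w A

-- A finite Kripke frame with points Fin m for the formulas over At₁ ⊇ At₀ ∪ • At₀. A point i of
-- Fin p records the theory ρ i of a world and the theory σ i of its • successors.
record Skeleton (At₀ At₁ : List Formula) (up : Relation m m) (ρ σ : Relation p m)
                (val : Formula → Subset m) : Set where
  field
    up-refl  : ∀ u → u ∈ˢ up u
    up-trans : ∀ u → UpClosed up (up u)
    ρ-up     : ∀ i → UpClosed up (ρ i)
    σ-up     : ∀ i → UpClosed up (σ i)
    ρ-open   : Open up ρ σ
    σ-open   : Open up σ ρ
    σ⊆ρ      : ∀ i → σ i ⊆ˢ ρ i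
    σ-cover  : ∀ u → ∃ λ i → u ∈ˢ σ i
    founded  : ∀ h → (∀ i → σ i ⊆ˢ h → ρ i ⊆ˢ h) → ∀ u → u ∈ˢ h
    val-up   : ∀ {a} → a ∈ At₁ → UpClosed up (val a)
    val-•    : ∀ {a} → a ∈ At₀ → ∀ i → (ρ i ⊆ˢ val (• a) → σ i ⊆ˢ val a) × (σ i ⊆ˢ val a → ρ i ⊆ˢ val (• a))

module Sequences (V : List ℕ) (d : ℕ) {up : Relation m m} {ρ σ : Relation p m} {val : Formula → Subset m}
                 (S : Skeleton (Atoms V d) (Atoms V (suc d)) up ρ σ val) where
  open Skeleton S

  ⟦_⟧ˢ : Formula → Subset m
  ⟦_⟧ˢ = ⟦_⟧ up val

  ⟦⇒⟧⁺ : ∀ {A B u} → (∀ {v} → v ∈ˢ up u → v ∈ˢ ⟦ A ⟧ˢ → v ∈ˢ ⟦ B ⟧ˢ) → u ∈ˢ ⟦ A ⇒ B ⟧ˢ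
  ⟦⇒⟧⁺ {A} {B} f = ∈⟪⟫⁺ (implies? up val A B) (λ v → f)

  ⟦⇒⟧⁻ : ∀ {A B u} → u ∈ˢ ⟦ A ⇒ B ⟧ˢ → ∀ {v} → v ∈ˢ up u → v ∈ˢ ⟦ A ⟧ˢ → v ∈ˢ ⟦ B ⟧ˢ
  ⟦⇒⟧⁻ {A} {B} u∈ = ∈⟪⟫⁻ (implies? up val A B) u∈ _

  ⟦⟧-up : ∀ {A} → Over (Atoms V (suc d)) A → UpClosed up ⟦ A ⟧ˢ
  ⟦⟧-up {var x} (atom a∈) = val-up a∈
  ⟦⟧-up {• A} (atom a∈) = val-up a∈
  ⟦⟧-up {A ⇒ B} _ u∈ v∈ = ⟦⇒⟧⁺ {A} {B} λ w∈ → ⟦⇒⟧⁻ {A} {B} u∈ (up-trans _ v∈ w∈)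

  mutual
    -- Extends `val-•` from atoms to implications. To test an implication at `v`, openness gives a
    -- point whose σ-trace is the cone of `v`; the converse lemma carries the antecedent over to its
    -- ρ-trace.
    ρ⇒σ : ∀ {A} → Over (Atoms V d) A → ∀ i → ρ i ⊆ˢ ⟦ shift A ⟧ˢ → σ i ⊆ˢ ⟦ A ⟧ˢ
    ρ⇒σ {var x} (atom a∈) i = proj₁ (val-• a∈ i)
    ρ⇒σ {• A} (atom a∈) i = proj₁ (val-• a∈ i)
    ρ⇒σ {A ⇒ B} (oA ⇒ oB) i h {u} u∈ = ⟦⇒⟧⁺ {A} {B} λ {v} v∈ v∈A →
      let j , v∈σj , σj⊆v , ρj⊆ρi = σ-open i v (σ-up i u∈ v∈)
          ρj⊆A = σ⇒ρ oA j (λ w∈ → ⟦⟧-up (over-suc V d oA) v∈A (σj⊆v w∈))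
      in ρ⇒σ oB j (λ w∈ → ⟦⇒⟧⁻ {shift A} {shift B} (h (ρj⊆ρi w∈)) (up-refl _) (ρj⊆A w∈)) v∈σj
    ρ⇒σ {A ⇒ B} (atom a∈) i = ⊥-elim (⇒∉Atoms V d a∈)

    σ⇒ρ : ∀ {A} → Over (Atoms V d) A → ∀ i → σ i ⊆ˢ ⟦ A ⟧ˢ → ρ i ⊆ˢ ⟦ shift A ⟧ˢ
    σ⇒ρ {var x} (atom a∈) i = proj₂ (val-• a∈ i)
    σ⇒ρ {• A} (atom a∈) i = proj₂ (val-• a∈ i)
    σ⇒ρ {A ⇒ B} (oA ⇒ oB) i h {u} u∈ = ⟦⇒⟧⁺ {shift A} {shift B} λ {v} v∈ v∈A →
      let j , v∈ρj , ρj⊆v , σj⊆σi = ρ-open i v (ρ-up i u∈ v∈)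
          σj⊆A = ρ⇒σ oA j (λ w∈ → ⟦⟧-up (over-shift V d oA) v∈A (ρj⊆v w∈))
      in σ⇒ρ oB j (λ w∈ → ⟦⇒⟧⁻ {A} {B} (h (σj⊆σi w∈)) (up-refl _) (σj⊆A w∈)) v∈ρj
    σ⇒ρ {A ⇒ B} (atom a∈) i = ⊥-elim (⇒∉Atoms V d a∈)

  Link' : Subset m → Subset m → Set
  Link' = Link ρ σ

  link-⊆ : ∀ {y z} → Link' y z → z ⊆ˢ y
  link-⊆ (_ , g) u∈ = let i , u∈σi , ρi⊆y , _ = g u∈ in ρi⊆y (σ⊆ρ i u∈σi)

  link-upˡ : ∀ {y z} → Link' y z → UpClosed up y
  link-upˡ (f , _) u∈ v∈ = let i , u∈ρi , ρi⊆y , _ = f u∈ in ρi⊆y (ρ-up i u∈ρi v∈)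

  link-shift : ∀ {A y z} → Over (Atoms V d) A → Link' y z →
    (y ⊆ˢ ⟦ shift A ⟧ˢ → z ⊆ˢ ⟦ A ⟧ˢ) × (z ⊆ˢ ⟦ A ⟧ˢ → y ⊆ˢ ⟦ shift A ⟧ˢ)
  link-shift oA (f , g) =
    (λ h u∈ → let i , u∈σi , ρi⊆y , _ = g u∈ in ρ⇒σ oA i (λ v∈ → h (ρi⊆y v∈)) u∈σi) ,
    (λ h u∈ → let i , u∈ρi , _ , σi⊆z = f u∈ in σ⇒ρ oA i (λ v∈ → h (σi⊆z v∈)) u∈ρi)

  -- Worlds and their frame

  record World : Set where
    field
      seq     : ℕ → Subset m
      linked  : ∀ k → Link' (seq k) (seq (suc k))
      extinct : ∃ λ n → ∀ {u} → u ∉ˢ seq n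
      -- Excludes the empty sequence, which would be its own `▷`-successor.
      alive   : ∃ λ u → u ∈ˢ seq 0

  open World

  infix 4 _≼_ _▷_
  _≼_ _▷_ : World → World → Set
  s ≼ t = ∀ k → seq t k ⊆ˢ seq s k
  s ▷ t = ∀ k → seq t k ⊆ˢ seq s (suc k)

  seq-up : ∀ s k → UpClosed up (seq s k)
  seq-up s k = link-upˡ (linked s k)

  -- The head of the `n`-th world is contained in the `n`-th member of the first, which is
  -- eventually empty, whereas heads are inhabited.
  no-chain : (f : ℕ → World) → ¬ (∀ n → f n ▷ f (suc n))
  no-chain f chain with extinct (f 0)
  ... | n , empty = empty (subst (λ k → proj₁ (alive (f n)) ∈ˢ seq (f 0) k) (+-identityʳ n) (shifted n 0 (proj₂ (alive (f n)))))
    where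
    shifted : ∀ n k → seq (f n) k ⊆ˢ seq (f 0) (n + k)
    shifted zero k v = v
    shifted (suc n) k {u} v = subst (λ l → u ∈ˢ seq (f 0) l) (+-suc n k) (shifted n (suc k) (chain n k v))

  -- The world `r` is `t'` with a new head, obtained by shrinking the first link of `s` from its
  -- right end. Its tail is `t'` itself, so all its successors lie above `t'`.
  ▷≼-lift : ∀ {s t t'} → s ▷ t → t ≼ t' → Σ World λ r → s ≼ r × r ▷ t' × (∀ q → r ▷ q → t' ≼ q)
  ▷≼-lift {s} {t} {t'} s▷t t≼t' = r , s≼r , (λ k → id) , λ q r▷q → r▷q
    where
    t'⊆s : ∀ k → seq t' k ⊆ˢ seq s (suc k)
    t'⊆s k v = s▷t k (t≼t' k v)
    shrunk = shrink σ-open (link-sym (linked s 0)) (t'⊆s 0) (seq-up t' 0)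
    link₀ = link-sym (proj₂ (proj₂ shrunk))
    r : World
    r .seq zero = proj₁ shrunk
    r .seq (suc k) = seq t' k
    r .linked zero = link₀
    r .linked (suc k) = linked t' k
    r .extinct = let n , e = extinct t' in suc n , e
    r .alive = let u , v = alive t' in u , link-⊆ link₀ v
    s≼r : s ≼ r
    s≼r zero = proj₁ (proj₂ shrunk)
    s≼r (suc k) = t'⊆s k

  frame : World → LAFrame
  frame w = record
    { W = World ; inhabited = w ; _▷_ = _▷_ ; R = _≼_
    ; noChain = λ (f , chain) → no-chain f chain
    ; R-refl = λ s k → id
    ; R-trans = λ pq qr k → pq k ∘ qr k
    ; R▷ = λ pq qr k → pq (suc k) ∘ qr k
    ; ▷⇒R = λ {s} pq k v → link-⊆ (linked s k) (pq k v)
    ; ▷R = λ {s} {t} {t'} → ▷≼-lift {s} {t} {t'} }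

  valuation : ℕ → World → Bool
  valuation x s = does (seq s 0 ⊆? val (var x))

  -- A smaller head is propagated along the sequence by applying `shrink` to one link after another.
  restrict : ∀ s y → y ⊆ˢ seq s 0 → UpClosed up y → (∃ λ u → u ∈ˢ y) → Σ World λ t → s ≼ t × seq t 0 ≡ y
  restrict s y y⊆s y-up ne = t , (λ k → proj₁ (proj₂ (trace k))) , refl
    where
    trace : ∀ k → Σ (Subset m) λ z → z ⊆ˢ seq s k × UpClosed up z
    next : ∀ k → Σ (Subset m) λ z' → z' ⊆ˢ seq s (suc k) × Link' (proj₁ (trace k)) z'
    trace zero = y , y⊆s , y-up
    trace (suc k) = let z , z⊆s , link = next k in z , z⊆s , link-upʳ link
      where
      link-upʳ : ∀ {y z} → Link' y z → UpClosed up z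
      link-upʳ (_ , g) u∈ v∈ = let i , u∈σi , _ , σi⊆z = g u∈ in σi⊆z (σ-up i u∈σi v∈)
    next k = shrink ρ-open (linked s k) (proj₁ (proj₂ (trace k))) (proj₂ (proj₂ (trace k)))
    t : World
    t .seq k = proj₁ (trace k)
    t .linked k = proj₂ (proj₂ (next k))
    t .extinct = let n , e = extinct s in n , λ v → e (proj₁ (proj₂ (trace n)) v)
    t .alive = ne

  truth : ∀ w {A} → Fits V (suc d) A → ∀ s →
    (forces (frame w) valuation s A → seq s 0 ⊆ˢ ⟦ push A ⟧ˢ) ×
    (seq s 0 ⊆ˢ ⟦ push A ⟧ˢ → forces (frame w) valuation s A)
  truth w {var x} (var _) s = does-true (seq s 0 ⊆? val (var x)) , dec-true (seq s 0 ⊆? val (var x))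
  truth w {A ⇒ B} (fA ⇒ fB) s = sound , complete
    where
    sound : forces (frame w) valuation s (A ⇒ B) → seq s 0 ⊆ˢ ⟦ push A ⇒ push B ⟧ˢ
    sound f {u} u∈ = ⟦⇒⟧⁺ {push A} {push B} λ {v} v∈ v∈A →
      -- A world above `s` whose head is the cone of `v`; truth throughout this head is truth at
      -- `v`.
      let t , s≼t , eq = restrict s (up v) (λ z∈ → seq-up s 0 (seq-up s 0 u∈ v∈) z∈) (up-trans v) (v , up-refl v)
          t⊆A = λ {z} z∈ → ⟦⟧-up (fits-over fA) v∈A (subst (z ∈ˢ_) eq z∈)
          t⊩B = f t s≼t (proj₂ (truth w fA t) t⊆A)
      in proj₁ (truth w fB t) t⊩B (subst (v ∈ˢ_) (sym eq) (up-refl v))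
    complete : seq s 0 ⊆ˢ ⟦ push A ⇒ push B ⟧ˢ → forces (frame w) valuation s (A ⇒ B)
    complete h t s≼t t⊩A = proj₂ (truth w fB t) λ u∈ →
      ⟦⇒⟧⁻ {push A} {push B} (h (s≼t 0 u∈)) (up-refl _) (proj₁ (truth w fA t) t⊩A u∈)
  truth w {• A} (• fA) s = sound , complete
    where
    shifted = link-shift (fits-over fA) (linked s 0)
    -- The least successor of `s`. It is a world only when `seq s 1` is inhabited; otherwise the
    -- inclusion to be shown is vacuous.
    tail : (∃ λ u → u ∈ˢ seq s 1) → World
    tail ne = record { seq = λ k → seq s (suc k) ; linked = λ k → linked s (suc k)
                     ; extinct = let n , e = extinct s in n , λ v → e (link-⊆ (linked s n) v) ; alive = ne }
    sound : forces (frame w) valuation s (• A) → seq s 0 ⊆ˢ ⟦ shift (push A) ⟧ˢ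
    sound f = proj₂ shifted λ {u} u∈ →
      proj₁ (truth w (fits-suc fA) (tail (u , u∈))) (f (tail (u , u∈)) (λ k → id)) u∈
    complete : seq s 0 ⊆ˢ ⟦ shift (push A) ⟧ˢ → forces (frame w) valuation s (• A)
    complete h t s▷t = proj₂ (truth w (fits-suc fA) t) λ u∈ → proj₁ shifted h (s▷t 0 u∈)

  hereditary : ∀ w → Hereditary (frame w) valuation
  hereditary w x {s} {t} s≼t v = dec-true (seq t 0 ⊆? val (var x)) λ u∈ → does-true (seq s 0 ⊆? val (var x)) v (s≼t 0 u∈)

  -- A world whose head contains every point

  record Ladder (h : Subset m) : Set where
    field
      steps   : ℕ → Subset m
      first   : steps 0 ≡ h
      joined  : ∀ k → Link' (steps k) (steps (suc k))
      ends    : ∃ λ n → ∀ {u} → u ∉ˢ steps n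

  open Ladder

  -- Prepend the union `h'` of all ρ-traces of points whose σ-trace lies in `h`. Either `h'` is
  -- strictly larger, or `h` is closed in the sense of `founded` and contains everything.
  climb : ∀ {h} → Acc _⊃_ h → Ladder h → Σ (Subset m) λ h' → Ladder h' × (∀ u → u ∈ˢ h')
  climb {h} (acc rec) l = go (any? λ u → (u ∈? h') ×-dec ¬? (u ∈? h))
    where
    above? : ∀ u → Dec (∃ λ i → u ∈ˢ ρ i × σ i ⊆ˢ h)
    above? u = any? λ i → (u ∈? ρ i) ×-dec (σ i ⊆? h)
    h' = ⟪ above? ⟫
    h-up : UpClosed up h
    h-up = subst (UpClosed up) (first l) (link-upˡ (joined l 0))
    ρ⊆h' : ∀ {i} → σ i ⊆ˢ h → ρ i ⊆ˢ h'
    ρ⊆h' {i} σi⊆h u∈ = ∈⟪⟫⁺ above? (i , u∈ , σi⊆h)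
    link : Link' h' h
    link = (λ u∈ → let i , u∈ρi , σi⊆h = ∈⟪⟫⁻ above? u∈ in i , u∈ρi , ρ⊆h' σi⊆h , σi⊆h) ,
           -- `σ-cover` gives a point seeing `u`, and openness cuts its σ-trace down to the cone of
           -- `u`, which lies in `h`.
           (λ {u} u∈ → let i , u∈σi = σ-cover u
                           j , u∈σj , σj⊆u , _ = σ-open i u u∈σi
                           σj⊆h = λ {v} v∈ → h-up u∈ {v} (σj⊆u v∈)
                       in j , u∈σj , ρ⊆h' σj⊆h , σj⊆h)
    l' : Ladder h'
    l' .steps zero = h'
    l' .steps (suc k) = steps l k
    l' .first = refl
    l' .joined zero = subst (Link' h') (sym (first l)) link
    l' .joined (suc k) = joined l k
    l' .ends = let n , e = ends l in suc n , e
    go : Dec (∃ λ u → u ∈ˢ h' × u ∉ˢ h) → Σ (Subset m) λ h' → Ladder h' × (∀ u → u ∈ˢ h')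
    go (yes new) = climb (rec (link-⊆ link , new)) l'
    go (no ¬new) = h , l , founded h λ i σi⊆h {u} u∈ →
      decidable-stable (u ∈? h) λ u∉h → ¬new (u , ρ⊆h' σi⊆h u∈ , u∉h)

  top : Σ (Subset m) λ h → Ladder h × (∀ u → u ∈ˢ h)
  top = climb (⊃-wellFounded ⊥) record
    { steps = λ _ → ⊥ ; first = refl
    ; joined = λ _ → (λ v → ⊥-elim (∉⊥ v)) , (λ v → ⊥-elim (∉⊥ v))
    ; ends = 0 , ∉⊥ }

  -- By `truth`, forcing at the single world with full head is truth at all points.
  skeleton-complete : ∀ {A} → Fits V (suc d) A → Valid A → ∀ u → u ∈ˢ ⟦ push A ⟧ˢ
  skeleton-complete fA valid u = proj₁ (truth w fA w) (valid (frame w) valuation (hereditary w) w) (proj₂ (alive w))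
    where
    l = proj₁ (proj₂ top)
    w : World
    w = record { seq = steps l ; linked = joined l ; extinct = ends l
               ; alive = u , subst (u ∈ˢ_) (sym (first l)) (proj₂ (proj₂ top) u) }

-- Points as frames, up to the removal of inconsistent points

_≟ᶠᵐ_ : (A B : Formula) → Dec (A ≡ B)
var x ≟ᶠᵐ var y = map′ (cong var) (λ { refl → refl }) (x ≟ⁿ y)
var x ≟ᶠᵐ (C ⇒ D) = no λ ()
var x ≟ᶠᵐ (• C) = no λ ()
(A ⇒ B) ≟ᶠᵐ var y = no λ ()
(A ⇒ B) ≟ᶠᵐ (C ⇒ D) = map′ (λ (p , q) → cong₂ _⇒_ p q) (λ { refl → refl , refl }) ((A ≟ᶠᵐ C) ×-dec (B ≟ᶠᵐ D))
(A ⇒ B) ≟ᶠᵐ (• C) = no λ ()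
(• A) ≟ᶠᵐ var y = no λ ()
(• A) ≟ᶠᵐ (C ⇒ D) = no λ ()
(• A) ≟ᶠᵐ (• C) = map′ (cong •_) (λ { refl → refl }) (A ≟ᶠᵐ C)

∀⊎ : ∀ {n} {A : Fin n → Set} {B : Set} → (∀ i → A i ⊎ B) → (∀ i → A i) ⊎ B
∀⊎ {n} f with ∀∈⊎ (allFin n) (λ {i} _ → f i)
... | inj₁ g = inj₁ λ i → g (∈-allFin i)
... | inj₂ b = inj₂ b

∀ˢ⊎ : ∀ {m} {A : Subset m → Set} {B : Set} → (∀ h → A h ⊎ B) → (∀ h → A h) ⊎ B
∀ˢ⊎ {zero} f = Sum.map₁ (λ { a [] → a }) (f [])
∀ˢ⊎ {suc m} f with ∀ˢ⊎ (λ h → f (true ∷ h)) | ∀ˢ⊎ (λ h → f (false ∷ h))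
... | inj₂ b | _ = inj₂ b
... | inj₁ _ | inj₂ b = inj₂ b
... | inj₁ g | inj₁ g' = inj₁ λ { (true ∷ h) → g h ; (false ∷ h) → g' h }

→⊎ : {A B C : Set} → Dec A → (A → B ⊎ C) → (A → B) ⊎ C
→⊎ (yes a) f = Sum.map₁ (λ b _ → b) (f a)
→⊎ (no ¬a) f = inj₁ λ a → ⊥-elim (¬a a)

⊆⊎ : {y z : Subset m} {C : Set} → (∀ {u} → u ∈ˢ y → u ∉ˢ z → C) → (y ⊆ˢ z) ⊎ C
⊆⊎ {y = y} {z} {C} f = Sum.map₁ (λ g {u} → g u) (∀⊎ λ u → →⊎ (u ∈? y) (step u))
  where
  step : ∀ u → u ∈ˢ y → u ∈ˢ z ⊎ C
  step u u∈y with u ∈? z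
  ... | yes u∈z = inj₁ u∈z
  ... | no u∉z = inj₂ (f u∈y u∉z)

⊈⇒∃ : {y z : Subset m} → ¬ (y ⊆ˢ z) → ∃ λ u → u ∈ˢ y × u ∉ˢ z
⊈⇒∃ y⊈z with ⊆⊎ (λ {u} u∈y u∉z → u , u∈y , u∉z)
... | inj₁ y⊆z = ⊥-elim (y⊈z y⊆z)
... | inj₂ r = r

Complete : ∀ {n} → (Fin n → Point At) → Set
Complete {At} Q = ∀ {Δ F} → Over At F → (∀ i → Refutes (Q i) F → Δ ++ ctx (Q i) ⊢ goal (Q i)) → Δ ⊢ F

Faulty : ∀ {n} → (Fin n → Point At) → Set
Faulty Q = ∃ λ i → Inconsistent (Q i)

-- The premise of `Complete` holds automatically at an inconsistent point.
remove-faulty : ∀ {n} (Q : Fin (suc n) → Point At) i → Inconsistent (Q i) → Complete Q → Complete (Q ∘ punchIn i)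
remove-faulty Q i inc compl {Δ} {F} oF h = compl oF step
  where
  step : ∀ j → Refutes (Q j) F → Δ ++ ctx (Q j) ⊢ goal (Q j)
  step j r with i ≟ᶠ j
  ... | yes refl = weaken (∈-++⁺ʳ Δ) inc
  ... | no i≢j = subst (λ k → Δ ++ ctx (Q k) ⊢ goal (Q k)) eq (h _ (subst (λ k → Refutes (Q k) F) (sym eq) r))
    where eq = punchIn-punchOut i≢j

descr⊢inconsistent : (w : Point At) → ctx w ⊢ descr w → Inconsistent w
descr⊢inconsistent w d = app* (ctx w) d ax

-- Traces of points, along the identity or one added bullet

record Modality (At At' : List Formula) : Set where
  field
    ⟨_⟩ : Formula → Formula
    ⟨⟩-⇒ : ∀ A B → ⟨ A ⇒ B ⟩ ≡ ⟨ A ⟩ ⇒ ⟨ B ⟩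
    ⟨⟩-mono : ∀ {Γ A} → Γ ⊢ A → map ⟨_⟩ Γ ⊢ ⟨ A ⟩
    ⟨⟩-over : ∀ {A} → Over At A → Over At' ⟨ A ⟩

  ⟨⟩-⇒* : ∀ Γ A → ⟨ Γ ⇒* A ⟩ ≡ map ⟨_⟩ Γ ⇒* ⟨ A ⟩
  ⟨⟩-⇒* [] A = refl
  ⟨⟩-⇒* (C ∷ Γ) A = trans (⟨⟩-⇒ C (Γ ⇒* A)) (cong (⟨ C ⟩ ⇒_) (⟨⟩-⇒* Γ A))

  ⟨⟩-cut : ∀ Γ {Δ A} → (∀ {C} → C ∈ Γ → Δ ⊢ ⟨ C ⟩) → Γ ⊢ A → Δ ⊢ ⟨ A ⟩
  ⟨⟩-cut Γ {Δ} σ d = cut σ' (⟨⟩-mono d)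
    where
    σ' : Δ ⊢* map ⟨_⟩ Γ
    σ' m with ∈-map⁻ ⟨_⟩ m
    ... | _ , m' , refl = σ m'

identity : ∀ {At At'} → (∀ {A} → Over At A → Over At' A) → Modality At At'
identity o = record
  { ⟨_⟩ = id ; ⟨⟩-⇒ = λ _ _ → refl ; ⟨⟩-mono = λ d → weaken (λ m → subst (_ ∈_) (sym (map-id _)) m) d ; ⟨⟩-over = o }

module Reflect {At At' : List Formula} {q m : ℕ} (U : Fin m → Point At) (Q : Fin q → Point At') (M : Modality At At') where
  open Modality M

  decideAt : ∀ i u → ctx (Q i) ⊢ ⟨ descr (U u) ⟩ ⊎ Refutes (Q i) ⟨ descr (U u) ⟩
  decideAt i u = decide (Q i) (⟨⟩-over (over (U u)))

  -- Asks only which alternative `decideAt` returns. This is decidable, and at an inconsistent point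
  -- both alternatives hold.
  refuted? : ∀ i u → Dec (∃ λ r → decideAt i u ≡ inj₂ r)
  refuted? i u with decideAt i u
  ... | inj₁ _ = no λ ()
  ... | inj₂ r = yes (r , refl)

  -- For consistent points: `u` belongs to the trace iff every `A` over the atoms with `⟨ A ⟩`
  -- derivable at `Q i` is derivable at `U u`, since `descr (U u)` is the weakest formula failing
  -- there.
  rel : Relation q m
  rel i = ⟪ refuted? i ⟫

  ∈rel : ∀ {i u} → u ∈ˢ rel i → Refutes (Q i) ⟨ descr (U u) ⟩
  ∈rel {i} u∈ = proj₁ (∈⟪⟫⁻ (refuted? i) u∈)

  ∉rel : ∀ {i u} → u ∉ˢ rel i → ctx (Q i) ⊢ ⟨ descr (U u) ⟩
  ∉rel {i} {u} u∉ with decideAt i u in eq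
  ... | inj₁ d = d
  ... | inj₂ r = ⊥-elim (u∉ (∈⟪⟫⁺ (refuted? i) (r , eq)))

  -- As `A` entails `descr (U u)`, the point `Q i` derives the image of that description, which it
  -- also refutes.
  clash : ∀ {i u A} → u ∈ˢ rel i → Refutes (U u) A → ctx (Q i) ⊢ ⟨ A ⟩ → Inconsistent (Q i)
  clash {u = u} u∈ r d = cut₁ (⟨⟩-cut (_ ∷ []) (λ { (here refl) → d }) (refutes-descr (U u) r)) (∈rel u∈)

  -- As hypotheses, these formulas rule out the points outside `h`.
  unseen : Subset m → Ctx
  unseen h = map (descr ∘ U) (filter (λ u → ¬? (u ∈? h)) (allFin m))

  ∈unseen⁺ : ∀ {h u} → u ∉ˢ h → descr (U u) ∈ unseen h
  ∈unseen⁺ {h} u∉ = ∈-map⁺ (descr ∘ U) (∈-filter⁺ (λ u → ¬? (u ∈? h)) (∈-allFin _) u∉)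

  ∈unseen⁻ : ∀ {h C} → C ∈ unseen h → ∃ λ u → u ∉ˢ h × C ≡ descr (U u)
  ∈unseen⁻ {h} m with ∈-map⁻ (descr ∘ U) m
  ... | u , m' , eq = u , proj₂ (∈-filter⁻ (λ u → ¬? (u ∈? h)) {xs = allFin _} m') , eq

  rel-derives : Complete U → ∀ i {F} → Over At F → (∀ u → u ∈ˢ rel i → ctx (U u) ⊢ F) → ctx (Q i) ⊢ ⟨ F ⟩
  rel-derives compl i {F} oF h = ⟨⟩-cut (unseen (rel i)) derived (compl oF step)
    where
    derived : ∀ {C} → C ∈ unseen (rel i) → ctx (Q i) ⊢ ⟨ C ⟩
    derived m with ∈unseen⁻ {rel i} m
    ... | u , u∉ , refl = ∉rel u∉
    step : ∀ u → Refutes (U u) F → unseen (rel i) ++ ctx (U u) ⊢ goal (U u)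
    step u r with u ∈? rel i
    ... | yes u∈ = weaken (∈-++⁺ʳ (unseen (rel i))) (cut₁ (h u u∈) r)
    ... | no u∉ = app* (ctx (U u)) (ax (∈-++⁺ˡ (∈unseen⁺ u∉))) (λ m → ax (∈-++⁺ʳ (unseen (rel i)) m))

module Atomic {At : List Formula} {m : ℕ} (U : Fin m → Point At) where
  val : Formula → Subset m
  val a = ⟪ (λ u → member _≟ᶠᵐ_ a (ctx (U u))) ⟫

  ∈val : ∀ {a u} → u ∈ˢ val a → ctx (U u) ⊢ a
  ∈val {a} u∈ = ax (∈⟪⟫⁻ (λ u → member _≟ᶠᵐ_ a (ctx (U u))) u∈)

  ∉val : ∀ {a u} → a ∈ At → u ∉ˢ val a → Refutes (U u) a
  ∉val {a} {u} a∈ u∉ with decide-atom (U u) a∈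
  ... | inj₁ m = ⊥-elim (u∉ (∈⟪⟫⁺ (λ u → member _≟ᶠᵐ_ a (ctx (U u))) m))
  ... | inj₂ r = r

module Transfer {At At' : List Formula} {q m : ℕ} (U : Fin m → Point At) (Q : Fin q → Point At') where
  open Atomic U

  module _ (M : Modality At At') where
    open Reflect U Q M
    open Reflect U U (identity id) using () renaming (rel to up; ∈rel to ∈up)

    rel-up : (∀ i → UpClosed up (rel i)) ⊎ Faulty Q
    rel-up = Sum.map₁ (λ f i {u} → f i u) (∀⊎ λ i → ∀⊎ λ u → →⊎ (u ∈? rel i) λ u∈ → Sum.map₁ (λ f {v} → f {v}) (⊆⊎ λ v∈ v∉ →
      i , clash u∈ (∈up v∈) (∉rel v∉)))

    derived⇒rel⊆val : ∀ {a} → a ∈ At → ∀ i → ctx (Q i) ⊢ Modality.⟨_⟩ M a → rel i ⊆ˢ val a ⊎ Faulty Q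
    derived⇒rel⊆val a∈ i d = ⊆⊎ λ u∈ u∉ → i , clash u∈ (∉val a∈ u∉) d

    rel⊆val⇒derived : Complete U → ∀ {a} → a ∈ At → ∀ i → rel i ⊆ˢ val a → ctx (Q i) ⊢ Modality.⟨_⟩ M a
    rel⊆val⇒derived compl a∈ i h = rel-derives compl i (atom a∈) λ u u∈ → ∈val (h u∈)

  module _ (M N : Modality At At') where
    open Modality M
    open Reflect U Q M
    open Reflect U Q N using () renaming (rel to rel'; ∈rel to ∈rel'; ∉rel to ∉rel')
    open Reflect U U (identity id) using () renaming (rel to up; ∈rel to ∈up; ∉rel to ∉up)

    -- If no `j` is good, completeness derives `⟨ descr (U u) ⟩` at `Q i`, against `u ∈ rel i`: each
    -- `Q j` refuting `⟨ goal (U u) ⟩` violates one of the three conditions, and each violation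
    -- yields the goal of `Q j`.
    rel-open : Complete Q → Open up rel rel' ⊎ Faulty Q
    rel-open compl = ∀⊎ λ i → ∀⊎ λ u → →⊎ (u ∈? rel i) λ u∈ → witness i u u∈ (any? (good? i u))
      where
      Good : Fin q → Fin m → Fin q → Set
      Good i u j = u ∈ˢ rel j × rel j ⊆ˢ up u × rel' j ⊆ˢ rel' i
      good? : ∀ i u j → Dec (Good i u j)
      good? i u j = (u ∈? rel j) ×-dec (rel j ⊆? up u) ×-dec (rel' j ⊆? rel' i)
      witness : ∀ i u → u ∈ˢ rel i → Dec (∃ (Good i u)) → ∃ (Good i u) ⊎ Faulty Q
      witness i u u∈ (yes w) = inj₁ w
      witness i u u∈ (no none) = inj₂ (i , cut₁ derivable (∈rel u∈))
        where
        Δ : Ctx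
        Δ = map ⟨_⟩ (ctx (U u)) ++ ctx (Q i)
        fromU : ∀ {A Θ} → ctx (U u) ⊢ A → Δ ++ Θ ⊢ ⟨ A ⟩
        fromU = ⟨⟩-cut (ctx (U u)) λ m → ax (∈-++⁺ˡ (∈-++⁺ˡ (∈-map⁺ ⟨_⟩ m)))
        fromQ : ∀ {A Θ} → ctx (Q i) ⊢ A → Δ ++ Θ ⊢ A
        fromQ = weaken (λ m → ∈-++⁺ˡ (∈-++⁺ʳ (map ⟨_⟩ (ctx (U u))) m))
        fromJ : ∀ {j A B} → A ∷ ctx (Q j) ⊢ B → Δ ++ ctx (Q j) ⊢ A → Δ ++ ctx (Q j) ⊢ B
        fromJ r d = cut (∷-⊢* d (λ m → ax (∈-++⁺ʳ Δ m))) r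
        step : ∀ j → Refutes (Q j) ⟨ goal (U u) ⟩ → Δ ++ ctx (Q j) ⊢ goal (Q j)
        step j r with u ∈? rel j
        ... | no u∉ = fromJ r (app* (map ⟨_⟩ (ctx (U u)))
                (subst (Δ ++ ctx (Q j) ⊢_) (⟨⟩-⇒* (ctx (U u)) (goal (U u))) (weaken (∈-++⁺ʳ Δ) (∉rel u∉)))
                (λ m → ax (∈-++⁺ˡ (∈-++⁺ˡ m))))
        ... | yes u∈j with rel j ⊆? up u
        ... | no ⊈ = let v , v∈ , v∉ = ⊈⇒∃ ⊈ in fromJ (∈rel v∈) (fromU (∉up v∉))
        ... | yes ⊆u with rel' j ⊆? rel' i
        ... | no ⊈ = let v , v∈ , v∉ = ⊈⇒∃ ⊈ in fromJ (∈rel' v∈) (fromQ (∉rel' v∉))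
        ... | yes ⊆i = ⊥-elim (none (j , u∈j , ⊆u , ⊆i))
        derivable : ctx (Q i) ⊢ ⟨ descr (U u) ⟩
        derivable = subst (ctx (Q i) ⊢_) (sym (⟨⟩-⇒* (ctx (U u)) (goal (U u))))
          (lam* (map ⟨_⟩ (ctx (U u))) (compl (⟨⟩-over (atom (goal∈At (U u)))) step))

-- A skeleton from two levels of points

module Analysis (V : List ℕ) (d : ℕ) {m p : ℕ}
                (U : Fin m → Point (Atoms V (suc d))) (P : Fin p → Point (Atoms V (suc (suc d))))
                (U-complete : Complete U) (P-complete : Complete P) where

  now later : Modality (Atoms V (suc d)) (Atoms V (suc (suc d)))
  now = identity (over-suc V (suc d))
  later = record { ⟨_⟩ = shift ; ⟨⟩-⇒ = λ _ _ → refl ; ⟨⟩-mono = shift-mono ; ⟨⟩-over = over-shift V (suc d) }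

  open Reflect U U (identity id) using () renaming (rel to up; ∈rel to ∈up; ∉rel to ∉up)
  open Reflect U P now using () renaming (rel to ρ; ∈rel to ∈ρ; ∉rel to ∉ρ)
  open Reflect U P later using () renaming (rel to σ; ∈rel to ∈σ; ∉rel to ∉σ)
  open Reflect U P now using (unseen; ∈unseen⁺; ∈unseen⁻)
  open Transfer U P
  open Atomic U
  module Self = Transfer U U

  valid-descr : ∀ u → [] ⊢ descr (U u) → Faulty U
  valid-descr u d = u , descr⊢inconsistent (U u) (weaken (λ ()) d)

  up-refl : (∀ u → u ∈ˢ up u) ⊎ Faulty U
  up-refl = ∀⊎ step
    where
    step : ∀ u → u ∈ˢ up u ⊎ Faulty U
    step u with u ∈? up u
    ... | yes u∈ = inj₁ u∈
    ... | no u∉ = inj₂ (u , descr⊢inconsistent (U u) (∉up u∉))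

  -- By rule C, a point deriving `descr (U u)` also derives its shift.
  σ⊆ρ : (∀ i → σ i ⊆ˢ ρ i) ⊎ Faulty P
  σ⊆ρ = Sum.map₁ (λ f i {u} → f i {u}) (∀⊎ λ i → ⊆⊎ λ {u} u∈ u∉ →
    i , cut₁ (•⊢shift (descr (U u)) (cRule (∉ρ u∉))) (∈σ u∈))

  -- If no point sees `u`, all of `P` derive the shift of `descr (U u)`, so it is a theorem; `unbox`
  -- makes `descr (U u)` a theorem, and `U u` is inconsistent.
  σ-cover : (∀ u → ∃ λ i → u ∈ˢ σ i) ⊎ Faulty U
  σ-cover = ∀⊎ step
    where
    step : ∀ u → (∃ λ i → u ∈ˢ σ i) ⊎ Faulty U
    step u with any? (λ i → u ∈? σ i)
    ... | yes w = inj₁ w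
    ... | no none = inj₂ (valid-descr u (unbox (shift⊢• (descr (U u))
      (P-complete (over-shift V (suc d) (over (U u))) λ i r → cut₁ (∉σ λ u∈ → none (i , u∈)) r))))

  -- If h is closed under passing from σ to ρ, Löb's rule derives the descriptions of all points outside h.
  founded : (∀ h → (∀ i → σ i ⊆ˢ h → ρ i ⊆ˢ h) → ∀ u → u ∈ˢ h) ⊎ Faulty U
  founded = ∀ˢ⊎ λ h → →⊎ (closed? h) λ closed → ∀⊎ (step h λ i → closed i)
    where
    closed? : ∀ h → Dec (∀ i → σ i ⊆ˢ h → ρ i ⊆ˢ h)
    closed? h = all? λ i → (σ i ⊆? h) →-dec (ρ i ⊆? h)
    step : ∀ h → (∀ i → σ i ⊆ˢ h → ρ i ⊆ˢ h) → ∀ u → u ∈ˢ h ⊎ Faulty U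
    step h closed u with u ∈? h
    ... | yes u∈ = inj₁ u∈
    ... | no u∉ = inj₂ (valid-descr u (löb* (unseen h) outside (∈unseen⁺ u∉)))
      where
      outside : •Ctx (unseen h) ++ [] ⊢* unseen h
      outside n with ∈unseen⁻ {h} n
      ... | v , v∉ , refl = P-complete (over-suc V (suc d) (over (U v))) refute
        where
        Θ : Ctx
        Θ = •Ctx (unseen h) ++ []
        refute : ∀ i → Refutes (P i) (descr (U v)) → Θ ++ ctx (P i) ⊢ goal (P i)
        -- Either closure puts `v` outside `ρ i`, so `P i` derives the refuted description, or some
        -- `w` in `σ i` outside `h` has its boxed description in `Θ`.
        refute i r with σ i ⊆? h
        ... | yes σ⊆h = weaken (∈-++⁺ʳ Θ) (cut₁ (∉ρ λ v∈ → v∉ (closed i σ⊆h v∈)) r)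
        ... | no σ⊈h = let w , w∈ , w∉ = ⊈⇒∃ σ⊈h in
          cut (∷-⊢* (•⊢shift (descr (U w)) (ax (∈-++⁺ˡ (∈-++⁺ˡ (∈-map⁺ •_ (∈unseen⁺ w∉))))))
                    (λ n' → ax (∈-++⁺ʳ Θ n'))) (∈σ w∈)

  val-up : (∀ {a} → a ∈ Atoms V (suc d) → UpClosed up (val a)) ⊎ Faulty U
  val-up = Sum.map₁ (λ f {a} a∈ {u} → f a∈ u) (∀∈⊎ (Atoms V (suc d)) λ {a} a∈ → ∀⊎ λ u → →⊎ (u ∈? val a) λ u∈ →
    Sum.map₁ (λ f {v} → f {v}) (Self.derived⇒rel⊆val (identity id) a∈ u (∈val {a} u∈)))

  -- Both inclusions amount to `P i` deriving `• a`, read through `now` as an atom and through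
  -- `later` as `shift a`.
  val-• : (∀ {a} → a ∈ Atoms V d → ∀ i →
    (ρ i ⊆ˢ val (• a) → σ i ⊆ˢ val a) × (σ i ⊆ˢ val a → ρ i ⊆ˢ val (• a))) ⊎ Faulty P
  val-• = ∀∈⊎ (Atoms V d) λ {a} a∈ → ∀⊎ λ i → both a a∈ i
    where
    both : ∀ a → a ∈ Atoms V d → ∀ i →
      ((ρ i ⊆ˢ val (• a) → σ i ⊆ˢ val a) × (σ i ⊆ˢ val a → ρ i ⊆ˢ val (• a))) ⊎ Faulty P
    both a a∈ i with →⊎ (ρ i ⊆? val (• a)) (λ h → derived⇒rel⊆val later (Atoms-suc V d a∈) i
                       (subst (ctx (P i) ⊢_) (sym (shift-atom V d a∈)) (rel⊆val⇒derived now U-complete (•∈Atoms V d a∈) i h)))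
                   | →⊎ (σ i ⊆? val a) (λ h → derived⇒rel⊆val now (•∈Atoms V d a∈) i
                       (subst (ctx (P i) ⊢_) (shift-atom V d a∈) (rel⊆val⇒derived later U-complete (Atoms-suc V d a∈) i h)))
    ... | inj₂ b | _ = inj₂ b
    ... | inj₁ _ | inj₂ b = inj₂ b
    ... | inj₁ f | inj₁ g = inj₁ ((λ h {u} → f h {u}) , (λ h {u} → g h {u}))

  ρ-open : Open up ρ σ ⊎ Faulty P
  ρ-open = rel-open now later P-complete

  σ-open : Open up σ ρ ⊎ Faulty P
  σ-open = rel-open later now P-complete

  infixl 1 _>>=_
  _>>=_ : ∀ {A B C : Set} → A ⊎ C → (A → B ⊎ C) → B ⊎ C
  inj₁ a >>= f = f a
  inj₂ c >>= f = inj₂ c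

  fromU : ∀ {A : Set} → A ⊎ Faulty U → A ⊎ (Faulty U ⊎ Faulty P)
  fromU = Sum.map₂ inj₁

  fromP : ∀ {A : Set} → A ⊎ Faulty P → A ⊎ (Faulty U ⊎ Faulty P)
  fromP = Sum.map₂ inj₂

  skeleton? : Skeleton (Atoms V d) (Atoms V (suc d)) up ρ σ val ⊎ (Faulty U ⊎ Faulty P)
  skeleton? = do
    r₁ ← fromU up-refl
    r₂ ← fromU (Self.rel-up (identity id))
    r₃ ← fromP (rel-up now)
    r₄ ← fromP (rel-up later)
    r₅ ← fromP ρ-open
    r₆ ← fromP σ-open
    r₇ ← fromP σ⊆ρ
    r₈ ← fromU σ-cover
    r₉ ← fromU founded
    r₁₀ ← fromU val-up
    r₁₁ ← fromP val-•
    inj₁ record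
      { up-refl = r₁ ; up-trans = λ u → r₂ u ; ρ-up = r₃ ; σ-up = r₄ ; ρ-open = r₅ ; σ-open = r₆
      ; σ⊆ρ = r₇ ; σ-cover = r₈ ; founded = r₉ ; val-up = r₁₀ ; val-• = r₁₁ }

  mutual
    -- Truth lemma for the finite frame. For an implication, a point `v` refuting `B` is excluded by
    -- its description at `u` if it is outside the cone, and by refuting `A` if `A` fails there;
    -- otherwise it is inconsistent.
    ∈⟦⟧ : ∀ {A} → Over (Atoms V (suc d)) A → ∀ {u} → u ∈ˢ ⟦_⟧ up val A → ctx (U u) ⊢ A
    ∈⟦⟧ {var x} (atom a∈) u∈ = ∈val u∈
    ∈⟦⟧ {• A} (atom a∈) u∈ = ∈val u∈
    ∈⟦⟧ {A ⇒ B} (atom a∈) u∈ = ⊥-elim (⇒∉Atoms V (suc d) a∈)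
    ∈⟦⟧ {A ⇒ B} (oA ⇒ oB) {u} u∈ = lam (U-complete oB step)
      where
      Δ : Ctx
      Δ = A ∷ ctx (U u)
      step : ∀ v → Refutes (U v) B → Δ ++ ctx (U v) ⊢ goal (U v)
      step v r with v ∈? up u
      ... | no v∉ = app* (ctx (U v)) (weaken (there ∘ ∈-++⁺ˡ) (∉up v∉)) (λ m → ax (∈-++⁺ʳ Δ m))
      ... | yes v∈ with v ∈? ⟦_⟧ up val A
      ... | no v∉A = weaken (∷⁺ʳ A (∈-++⁺ʳ (ctx (U u)))) (∉⟦⟧ oA v∉A)
      ... | yes v∈A = weaken (∈-++⁺ʳ Δ) (cut₁ (∈⟦⟧ oB (∈⟪⟫⁻ (implies? up val A B) u∈ v v∈ v∈A)) r)

    ∉⟦⟧ : ∀ {A} → Over (Atoms V (suc d)) A → ∀ {u} → u ∉ˢ ⟦_⟧ up val A → Refutes (U u) A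
    ∉⟦⟧ {var x} (atom a∈) u∉ = ∉val a∈ u∉
    ∉⟦⟧ {• A} (atom a∈) u∉ = ∉val a∈ u∉
    ∉⟦⟧ {A ⇒ B} (atom a∈) u∉ = ⊥-elim (⇒∉Atoms V (suc d) a∈)
    ∉⟦⟧ {A ⇒ B} (oA ⇒ oB) {u} u∉
      with any? (λ v → (v ∈? up u) ×-dec (v ∈? ⟦_⟧ up val A) ×-dec ¬? (v ∈? ⟦_⟧ up val B))
    ... | yes (v , v∈ , v∈A , v∉B) = cut (∷-⊢* (weaken (λ { (here refl) → here refl }) (refutes-descr (U v) A⇒B-refuted)) (ax ∘ there)) (∈up v∈)
      where
      A⇒B-refuted : Refutes (U v) (A ⇒ B)
      A⇒B-refuted = cut (∷-⊢* (app (ax (here refl)) (weaken∷ (∈⟦⟧ oA v∈A))) (ax ∘ there)) (∉⟦⟧ oB v∉B)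
    ... | no none = ⊥-elim (u∉ (∈⟪⟫⁺ (implies? up val A B) λ v v∈ v∈A →
      decidable-stable (v ∈? ⟦_⟧ up val B) λ v∉B → none (v , v∈ , v∈A , v∉B)))

  derive : ∀ {A} → Over (Atoms V (suc d)) A → (∀ u → u ∈ˢ ⟦_⟧ up val A) → [] ⊢ A
  derive oA h = U-complete oA λ u r → cut₁ (∈⟦⟧ oA (h u)) r

  derive-valid : ∀ {A} → Fits V (suc d) A → Valid A → [] ⊢ push A ⊎ (Faulty U ⊎ Faulty P)
  derive-valid {A} fA valid = Sum.map₁ fromSkeleton skeleton?
    where
    fromSkeleton : Skeleton (Atoms V d) (Atoms V (suc d)) up ρ σ val → [] ⊢ push A
    fromSkeleton S = derive (fits-over fA) (Sequences.skeleton-complete V d {up = up} {ρ} {σ} {val} S fA valid)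

-- Discarding inconsistent points

eliminate : ∀ V d {A} → Fits V (suc d) A → Valid A → ∀ m p
  (U : Fin m → Point (Atoms V (suc d))) (P : Fin p → Point (Atoms V (suc (suc d)))) →
  Complete U → Complete P → [] ⊢ push A
eliminate V d fA valid m p U P cU cP with Analysis.derive-valid V d U P cU cP fA valid
eliminate V d fA valid m p U P cU cP | inj₁ derivation = derivation
-- Each fault removes one point from `U` or `P`, so repeating the analysis terminates.
eliminate V d fA valid (suc m) p U P cU cP | inj₂ (inj₁ (u , inc)) =
  eliminate V d fA valid m p (U ∘ punchIn u) P (remove-faulty U u inc cU) cP
eliminate V d fA valid m (suc p) U P cU cP | inj₂ (inj₂ (i , inc)) =
  eliminate V d fA valid m p U (P ∘ punchIn i) cU (remove-faulty P i inc cP)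

complete-points : ∀ At → ∃ λ n → Σ (Fin n → Point At) Complete
complete-points At = let C , sep = diego [] (fromList At) (λ ()) from-At cover in
  _ , List.lookup C , λ oF h → sep oF (λ ()) λ {w} m r →
    subst (λ w → _ ++ ctx w ⊢ goal w) (sym (lookup-index m)) (h (index m) (subst (λ w → Refutes w _) (lookup-index m) r))
  where
  lookup-fromList : ∀ (xs : List Formula) i → lookup (fromList xs) i ∈ xs
  lookup-fromList (x ∷ xs) zero = here refl
  lookup-fromList (x ∷ xs) (suc i) = there (lookup-fromList xs i)
  from-At = lookup-fromList At
  position : ∀ {a} (xs : List Formula) → a ∈ xs → ∃ λ i → lookup (fromList xs) i ≡ a
  position (x ∷ xs) (here eq) = zero , sym eq
  position (x ∷ xs) (there m) = let i , eq = position xs m in suc i , eq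
  cover : ∀ {a} → a ∈ At → a ∈ [] ⊎ ∃ λ i → lookup (fromList At) i ≡ a
  cover m = inj₂ (position At m)

-- From pushed formulas back to arbitrary ones

mutual
  push⊢ : ∀ A {Γ} → Γ ⊢ push A → Γ ⊢ A
  push⊢ (var x) d = d
  push⊢ (A ⇒ B) d = lam (push⊢ B (app (weaken∷ d) (⊢push A (ax (here refl)))))
  push⊢ (• A) d = cut₁ (shift⊢• (push A) d)
    (weaken (λ { (here refl) → here refl }) (•-mono {push A ∷ []} (push⊢ A (ax (here refl)))))

  ⊢push : ∀ A {Γ} → Γ ⊢ A → Γ ⊢ push A
  ⊢push (var x) d = d
  ⊢push (A ⇒ B) d = lam (⊢push B (app (weaken∷ d) (push⊢ A (ax (here refl)))))
  ⊢push (• A) d = •⊢shift (push A) (cut₁ d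
    (weaken (λ { (here refl) → here refl }) (•-mono {A ∷ []} (⊢push A (ax (here refl))))))

vars : Formula → List ℕ
vars (var x) = x ∷ []
vars (A ⇒ B) = vars A ++ vars B
vars (• A) = vars A

fits-+ : ∀ {V n A} k → Fits V n A → Fits V (k + n) A
fits-+ zero f = f
fits-+ (suc k) f = fits-suc (fits-+ k f)

fits : ∀ {V} A → vars A ⊆ V → ∃ λ n → Fits V n A
fits (var x) vs = 0 , var (vs (here refl))
fits {V} (A ⇒ B) vs with fits A (vs ∘ ∈-++⁺ˡ) | fits B (vs ∘ ∈-++⁺ʳ (vars A))
... | j , fA | k , fB = j + k , subst (λ n → Fits V n A) (+-comm k j) (fits-+ k fA) ⇒ fits-+ j fB
fits (• A) vs = let n , fA = fits A vs in suc n , • fA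

weak-completeness : ∀ A → Valid A → [] ⊢ A
weak-completeness A valid =
  let d , fA = fits A id
      -- The skeleton relates the atoms of `U` to a level below, so the depth bound `d` is raised by
      -- one; `P` lies one level higher still.
      m , U , cU = complete-points (Atoms (vars A) (suc d))
      p , P , cP = complete-points (Atoms (vars A) (suc (suc d)))
  in push⊢ A (eliminate (vars A) d (fits-suc fA) valid m p U P cU cP)

module _ (F : LAFrame) (ξ : Valuation F) (her : Hereditary F ξ) where
  open LAFrame F

  forces-mono : ∀ A {p q} → R p q → forces F ξ p A → forces F ξ q A
  forces-mono (var x) pq f = her x pq f
  forces-mono (A ⇒ B) pq f r qr = f r (R-trans pq qr)
  forces-mono (• A) pq f r qr = f r (R▷ pq qr)

  forces-⇒* : ∀ Γ {B p} → (∀ q → R p q → (∀ A → A ∈ Γ → forces F ξ q A) → forces F ξ q B) → forces F ξ p (Γ ⇒* B)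
  forces-⇒* [] f = f _ (R-refl _) (λ _ ())
  forces-⇒* (C ∷ Γ) f q pq fC = forces-⇒* Γ λ r qr h → f r (R-trans pq qr) λ
    { _ (here refl) → forces-mono C qr fC ; A (there m) → h A m }

theorem10p20 : (Γ : List Formula) (B : Formula) →
    ((F : LAFrame) (ξ : Valuation F) → Hereditary F ξ →
    (p : LAFrame.W F) → (∀ A → A ∈ Γ → forces F ξ p A) → forces F ξ p B) →
    Γ ⊢ B
theorem10p20 Γ B valid = app* Γ (weaken (λ ()) (weak-completeness (Γ ⇒* B)
  λ F ξ her w → forces-⇒* F ξ her Γ λ q _ → valid F ξ her q)) ax
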